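{- Let $R$ be a ceer and let $=_{S(R)}$ be the congruence on $X^+$ defined below. Then $=_{S(R)}$ is isomorphic (as an equivalence relation) to $R\oplus\Id_\omega$; in particular ${=_{S(R)}}\equiv_{\mathrm{c}} R\oplus \Id_\omega$.
   Context: A ceer is a computably enumerable equivalence relation on $\omega$. $X^+$ is the set of nonempty finite words on $X=\{a,b\}$ with concatenation, identified with $\omega$ by a fixed computable coding; $u^i$ is $u$ concatenated $i$ times. Let $C=\{ab^ia: i\ge 1\}$, let $C_+$ be the set of words not in $C$ which contain some word of $C$ as a subword (i.e.\ $w=vuv'$ with $u\in C$, $v,v'$ possibly empty), and $C_-=X^+\setminus(C\cup C_+)$. $=_{S(R)}$ is the smallest congruence on $X^+$ (equivalence relation compatible with concatenation) containing all pairs $(ab^{i+1}a, ab^{j+1}a)$ with $i\mathrel{R}j$ and all pairs $(v,w)$ with $v,w\in C_+$; $S(R)=X^+/{=_{S(R)}}$. $\Id_\omega$ is equality on $\omega$; $U\oplus V=\{(2x,2y):x\mathrel{U}y\}\cup\{(2x+1,2y+1):x\mathrel{V}y\}$. $R\le_{\mathrm{c}}S$ means there is a computable $f$ with $x\mathrel{R}y\Leftrightarrow f(x)\mathrel{S}f(y)$, and $\equiv_{\mathrm{c}}$ is mutual $\le_{\mathrm{c}}$. Equivalence relations $U,V$ on $\omega$ are isomorphic if there is a computable $f$ reducing $U$ to $V$ (in the sense of $\le_{\mathrm{c}}$) whose range meets every $V$-equivalence class. -}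

module Defs where

open import Data.Nat using (ℕ; zero; suc; _+_; _*_; _≥_)
open import Data.List using (List; []; _∷_; _++_; replicate)
open import Data.List.NonEmpty using (List⁺; _∷_; toList; _⁺++⁺_)
open import Data.Product using (Σ; ∃; ∃-syntax; _×_; _,_)
open import Data.Bool using (Bool; true)
open import Relation.Nullary using (¬_)
open import Relation.Binary.PropositionalEquality using (_≡_)
open import Relation.Binary.Structures using (IsEquivalence)

data Letter : Set where
  a b : Letter

Word : Set
Word = List⁺ Letter

abᵢa : ℕ → Word
abᵢa i = a ∷ (replicate i b ++ (a ∷ []))

InC : Word → Set
InC w = Σ ℕ λ i → (i ≥ 1) × (w ≡ abᵢa i)

ContainsC : Word → Set
ContainsC w = Σ (List Letter) λ v → Σ Word λ u → Σ (List Letter) λ v' →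
  InC u × (toList w ≡ v ++ toList u ++ v')

InC₊ : Word → Set
InC₊ w = ContainsC w × ¬ InC w

data SR (R : ℕ → ℕ → Set) : Word → Word → Set where
  gen   : ∀ {i j} → R i j → SR R (abᵢa (suc i)) (abᵢa (suc j))
  plus  : ∀ {v w} → InC₊ v → InC₊ w → SR R v w
  refl  : ∀ {v} → SR R v v
  sym   : ∀ {v w} → SR R v w → SR R w v
  trans : ∀ {u v w} → SR R u v → SR R v w → SR R u w
  cong  : ∀ {v w v' w'} → SR R v w → SR R v' w' → SR R (v ⁺++⁺ v') (w ⁺++⁺ w')

Iff : Set → Set → Set
Iff A B = (A → B) × (B → A)

-- R is a ceer: an equivalence relation on ℕ that is c.e., i.e. the union
-- over stages s of a decidable (Bool-valued, computable) relation E s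
IsCeer : (ℕ → ℕ → Set) → Set
IsCeer R = IsEquivalence R ×
  (Σ (ℕ → ℕ → ℕ → Bool) λ E → ∀ x y → Iff (R x y) (∃[ s ] (E s x y ≡ true)))

data _⊕_ (U V : ℕ → ℕ → Set) : ℕ → ℕ → Set where
  inl : ∀ {x y} → U x y → (U ⊕ V) (2 * x) (2 * y)
  inr : ∀ {x y} → V x y → (U ⊕ V) (suc (2 * x)) (suc (2 * y))

Idω : ℕ → ℕ → Set
Idω x y = x ≡ y

-- reductions (computable functions = Agda functions)
_≤c_via_ : {A B : Set} → (A → A → Set) → (B → B → Set) → (A → B) → Set
_≤c_via_ {A} U V f = ∀ x y → Iff (U x y) (V (f x) (f y))

Isomorphic : {A B : Set} → (A → A → Set) → (B → B → Set) → Set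
Isomorphic {A} {B} U V = Σ (A → B) λ f → (U ≤c V via f) × (∀ y → Σ A λ x → V (f x) y)

_≡c_ : {A B : Set} → (A → A → Set) → (B → B → Set) → Set
_≡c_ {A} {B} U V = (Σ (A → B) λ f → U ≤c V via f) × (Σ (B → A) λ g → V ≤c U via g)

{-# OPTIONS --safe #-}
module Submission where

-- A nonempty word lies in C, in C₊, or in C₋, and the words of C₋ are exactly the
-- b^k a^m b^l (with l = 0 when m = 0).  A finite automaton reading the word from
-- left to right decides which case holds and computes the exponents.  C₊ absorbs
-- concatenation: a product with a factor containing a word of C contains one
-- itself, and it is not in C (a word of C has only two a's, its first and last
-- letters).  Hence the =_{S(R)}-classes are C₊, the singletons of C₋ and the
-- R-classes of the words a b^{i+1} a, so sending a b^{i+1} a to 2i and the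
-- remaining classes bijectively onto the odd numbers is a surjective reduction
-- to R ⊕ Idω; any section of it is a reduction back.

open import Defs
open import Data.Nat using (ℕ; zero; suc; _+_; _*_; s≤s; z≤n)
open import Data.Nat.Properties using (+-suc; +-identityʳ; +-comm; *-suc; *-cancelˡ-≡; suc-injective; even≢odd)
open import Data.Product using (_×_; Σ; _,_; proj₁; proj₂)
open import Data.Sum using (_⊎_; inj₁; inj₂; map₁)
open import Data.Sum.Relation.Binary.Pointwise using (Pointwise; inj₁; inj₂; ⊎-isEquivalence)
open import Data.Empty using (⊥; ⊥-elim)
open import Data.List using (List; []; _∷_; _++_; replicate; foldl)
open import Data.List.Properties using (++-assoc; ++-identityʳ; foldl-++)
open import Data.List.NonEmpty using (_∷_; toList; _⁺++⁺_)
open import Function using (_∘_)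
open import Function.Definitions using (StrictlySurjective)
open import Relation.Binary.Definitions using (Reflexive)
open import Relation.Binary.PropositionalEquality as ≡ using (_≡_; _≢_; refl; subst; subst₂)
open import Relation.Binary.Structures using (IsEquivalence)
open ≡.≡-Reasoning

module _ {A B : Set} {U : A → A → Set} {V : B → B → Set} where

  ≤c-inverse : ∀ {f g} → U ≤c V via f → (∀ y → f (g y) ≡ y) → V ≤c U via g
  ≤c-inverse {g = g} red fg x y =
    (λ v → proj₂ (red (g x) (g y)) (subst₂ V (≡.sym (fg x)) (≡.sym (fg y)) v)) ,
    (λ u → subst₂ V (fg x) (fg y) (proj₁ (red (g x) (g y)) u))

  surjective-reduction⇒isomorphic : ∀ {f} → Reflexive U → U ≤c V via f →
    StrictlySurjective _≡_ f → Isomorphic U V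
  surjective-reduction⇒isomorphic {f} reflU red surj = f , red , λ y →
    proj₁ (surj y) , subst (V (f (proj₁ (surj y)))) (proj₂ (surj y)) (proj₁ (red _ _) reflU)

  surjective-reduction⇒≡c : ∀ {f} → U ≤c V via f → StrictlySurjective _≡_ f → U ≡c V
  surjective-reduction⇒≡c {f} red surj =
    (f , red) , (proj₁ ∘ surj , ≤c-inverse red (proj₂ ∘ surj))

≤c-∘ : ∀ {A B C : Set} {U : A → A → Set} {V : B → B → Set} {W : C → C → Set} {f g} →
  U ≤c V via f → V ≤c W via g → U ≤c W via (g ∘ f)
≤c-∘ red red′ x y = proj₁ (red′ _ _) ∘ proj₁ (red x y) , proj₂ (red x y) ∘ proj₂ (red′ _ _)

strictlySurjective-∘ : ∀ {A B C : Set} {f : A → B} {g : B → C} →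
  StrictlySurjective _≡_ f → StrictlySurjective _≡_ g → StrictlySurjective _≡_ (g ∘ f)
strictlySurjective-∘ {g = g} surj-f surj-g z with surj-g z
... | y , gy≡z with surj-f y
...   | x , fx≡y = x , ≡.trans (≡.cong g fx≡y) gy≡z

encode : ℕ ⊎ ℕ → ℕ
encode (inj₁ x) = 2 * x
encode (inj₂ y) = suc (2 * y)

encode-injective : ∀ p q → encode p ≡ encode q → p ≡ q
encode-injective (inj₁ x) (inj₁ y) e = ≡.cong inj₁ (*-cancelˡ-≡ x y 2 e)
encode-injective (inj₁ x) (inj₂ y) e = ⊥-elim (even≢odd x y e)
encode-injective (inj₂ x) (inj₁ y) e = ⊥-elim (even≢odd y x (≡.sym e))
encode-injective (inj₂ x) (inj₂ y) e = ≡.cong inj₂ (*-cancelˡ-≡ x y 2 (suc-injective e))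

encode-surjective : StrictlySurjective _≡_ encode
encode-surjective zero = inj₁ 0 , refl
encode-surjective (suc n) with encode-surjective n
... | inj₁ x , refl = inj₂ x , refl
... | inj₂ y , refl = inj₁ (suc y) , *-suc 2 y

encode-reduction : ∀ {U V : ℕ → ℕ → Set} → Pointwise U V ≤c (U ⊕ V) via encode
encode-reduction {U} {V} p q = to , from p q refl refl
  where
  to : Pointwise U V p q → (U ⊕ V) (encode p) (encode q)
  to (inj₁ u) = inl u
  to (inj₂ v) = inr v
  from : ∀ p q {m n} → m ≡ encode p → n ≡ encode q → (U ⊕ V) m n → Pointwise U V p q
  from p q ep eq (inl {x} {y} u) with encode-injective (inj₁ x) p ep | encode-injective (inj₁ y) q eq
  ... | refl | refl = inj₁ u
  from p q ep eq (inr {x} {y} v) with encode-injective (inj₂ x) p ep | encode-injective (inj₂ y) q eq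
  ... | refl | refl = inj₂ v

triangle : ℕ → ℕ
triangle zero    = zero
triangle (suc d) = suc d + triangle d

pair : ℕ × ℕ → ℕ
pair (m , l) = triangle (m + l) + m

next : ℕ × ℕ → ℕ × ℕ
next (m , zero)  = zero , suc m
next (m , suc l) = suc m , l

unpair : ℕ → ℕ × ℕ
unpair zero    = 0 , 0
unpair (suc n) = next (unpair n)

pair-next : ∀ p → pair (next p) ≡ suc (pair p)
pair-next (m , zero) = begin
  triangle (suc m) + 0        ≡⟨ +-identityʳ _ ⟩
  suc (m + triangle m)        ≡⟨ ≡.cong suc (+-comm m (triangle m)) ⟩
  suc (triangle m + m)        ≡⟨ ≡.cong (λ d → suc (triangle d + m)) (≡.sym (+-identityʳ m)) ⟩
  suc (triangle (m + 0) + m)  ∎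
pair-next (m , suc l) = begin
  triangle (suc (m + l)) + suc m  ≡⟨ +-suc _ m ⟩
  suc (triangle (suc (m + l)) + m) ≡⟨ ≡.cong (λ d → suc (triangle d + m)) (≡.sym (+-suc m l)) ⟩
  suc (triangle (m + suc l) + m)   ∎

pair-unpair : ∀ n → pair (unpair n) ≡ n
pair-unpair zero    = refl
pair-unpair (suc n) = ≡.trans (pair-next (unpair n)) (≡.cong suc (pair-unpair n))

unpair-pair : ∀ p → unpair (pair p) ≡ p
unpair-pair (m , l) = on-diagonal (m + l) m l refl
  where
  on-diagonal : ∀ d m l → m + l ≡ d → unpair (pair (m , l)) ≡ (m , l)
  on-diagonal _       zero    zero    _ = refl
  on-diagonal zero    zero    (suc l) ()
  on-diagonal (suc d) zero    (suc l) e = ≡.trans (≡.cong unpair (pair-next (l , zero)))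
    (≡.cong next (on-diagonal d l zero (≡.trans (+-identityʳ l) (suc-injective e))))
  on-diagonal d       (suc m) l       e = ≡.trans (≡.cong unpair (pair-next (m , suc l)))
    (≡.cong next (on-diagonal d m (suc l) (≡.trans (+-suc m l) e)))

data State : Set where
  b⁺      : ℕ → State
  b*a⁺    : ℕ → ℕ → State
  b*a⁺b⁺  : ℕ → ℕ → ℕ → State
  c       : ℕ → State
  c₊      : State

ContainsL : List Letter → Set
ContainsL w = Σ (List Letter) λ v → Σ Word λ u → Σ (List Letter) λ v′ →
  InC u × (w ≡ v ++ toList u ++ v′)

Spells : State → List Letter → Set
Spells (b⁺ k)         w = w ≡ replicate (suc k) b
Spells (b*a⁺ k m)     w = w ≡ replicate k b ++ replicate (suc m) a
Spells (b*a⁺b⁺ k m l) w = w ≡ replicate k b ++ replicate (suc m) a ++ replicate (suc l) b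
Spells (c l)          w = w ≡ toList (abᵢa (suc l))
Spells c₊             w = ContainsL w

b*a⁺b⁺a : ℕ → ℕ → ℕ → State
b*a⁺b⁺a k       (suc m) l = c₊
b*a⁺b⁺a zero    zero    l = c l
b*a⁺b⁺a (suc k) zero    l = c₊

step : State → Letter → State
step (b⁺ k)         a = b*a⁺ (suc k) 0
step (b⁺ k)         b = b⁺ (suc k)
step (b*a⁺ k m)     a = b*a⁺ k (suc m)
step (b*a⁺ k m)     b = b*a⁺b⁺ k m 0
step (b*a⁺b⁺ k m l) a = b*a⁺b⁺a k m l
step (b*a⁺b⁺ k m l) b = b*a⁺b⁺ k m (suc l)
step (c l)          _ = c₊
step c₊             _ = c₊

start : Letter → State
start a = b*a⁺ 0 0
start b = b⁺ 0

run : State → List Letter → State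
run = foldl step

state : Word → State
state (x ∷ xs) = run (start x) xs

state-++ : ∀ v w → state (v ⁺++⁺ w) ≡ run (state v) (toList w)
state-++ (x ∷ xs) w = foldl-++ step (start x) xs (toList w)

run-replicate : (σ : ℕ → State) (x : Letter) → (∀ n → step (σ n) x ≡ σ (suc n)) →
  ∀ k n ys → run (σ n) (replicate k x ++ ys) ≡ run (σ (k + n)) ys
run-replicate σ x σ-step zero    n ys = refl
run-replicate σ x σ-step (suc k) n ys = begin
  run (step (σ n) x) (replicate k x ++ ys) ≡⟨ ≡.cong (λ s → run s (replicate k x ++ ys)) (σ-step n) ⟩
  run (σ (suc n)) (replicate k x ++ ys)    ≡⟨ run-replicate σ x σ-step k (suc n) ys ⟩
  run (σ (k + suc n)) ys                    ≡⟨ ≡.cong (λ j → run (σ j) ys) (+-suc k n) ⟩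
  run (σ (suc k + n)) ys                    ∎

run-c₊ : ∀ xs → run c₊ xs ≡ c₊
run-c₊ []       = refl
run-c₊ (_ ∷ xs) = run-c₊ xs

state-abᵢa : ∀ i → state (abᵢa (suc i)) ≡ c i
state-abᵢa i = ≡.trans (run-replicate (b*a⁺b⁺ 0 0) b (λ _ → refl) i 0 (a ∷ [])) (≡.cong c (+-identityʳ i))

-- The states reached exactly by the words containing a word of C
data HasC : State → Set where
  at-c  : ∀ {l} → HasC (c l)
  at-c₊ : HasC c₊

hasC-run⁺ : ∀ {st} → HasC st → ∀ x xs → run st (x ∷ xs) ≡ c₊
hasC-run⁺ at-c  _ xs = run-c₊ xs
hasC-run⁺ at-c₊ _ xs = run-c₊ xs

hasC-run : ∀ {st} → HasC st → ∀ xs → HasC (run st xs)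
hasC-run h []       = h
hasC-run h (x ∷ xs) = subst HasC (≡.sym (hasC-run⁺ h x xs)) at-c₊

hasC-b*a⁺b⁺a : ∀ k m l → HasC (b*a⁺b⁺a k m l)
hasC-b*a⁺b⁺a k       (suc m) l = at-c₊
hasC-b*a⁺b⁺a zero    zero    l = at-c
hasC-b*a⁺b⁺a (suc k) zero    l = at-c₊

hasC⇒≡c₊ : ∀ {st} → HasC st → (∀ l → st ≢ c l) → st ≡ c₊
hasC⇒≡c₊ at-c  st≢c = ⊥-elim (st≢c _ refl)
hasC⇒≡c₊ at-c₊ _    = refl

run-abᵢa : ∀ st i → run st (toList (abᵢa (suc i))) ≡ c₊
run-abᵢa (b⁺ k)         i = run-replicate (b*a⁺b⁺ (suc k) 0) b (λ _ → refl) i 0 (a ∷ [])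
run-abᵢa (b*a⁺ k m)     i = run-replicate (b*a⁺b⁺ k (suc m)) b (λ _ → refl) i 0 (a ∷ [])
run-abᵢa (b*a⁺b⁺ k m l) i = hasC-run⁺ (hasC-b*a⁺b⁺a k m l) b (replicate i b ++ a ∷ [])
run-abᵢa (c l)          i = run-c₊ (toList (abᵢa (suc i)))
run-abᵢa c₊             i = run-c₊ (toList (abᵢa (suc i)))

run-containsC : ∀ st {w} → ContainsL w → run st w ≡ c₊
run-containsC st (_ , _ , _ , (zero , () , _) , _)
run-containsC st (v , _ , v′ , (suc i , _ , refl) , refl) = begin
  run st (v ++ u ++ v′)               ≡⟨ foldl-++ step st v (u ++ v′) ⟩
  run (run st v) (u ++ v′)            ≡⟨ foldl-++ step (run st v) u v′ ⟩
  run (run (run st v) u) v′           ≡⟨ ≡.cong (λ s → run s v′) (run-abᵢa (run st v) i) ⟩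
  run c₊ v′                           ≡⟨ run-c₊ v′ ⟩
  c₊                                  ∎
  where u = toList (abᵢa (suc i))

containsC⇒hasC : ∀ w → ContainsC w → HasC (state w)
containsC⇒hasC _ (_ , _ , _ , (zero , () , _) , _)
containsC⇒hasC _ ([] , _ , v′ , (suc i , _ , refl) , refl) =
  subst HasC (≡.sym (foldl-++ step (start a) (replicate (suc i) b ++ a ∷ []) v′))
    (hasC-run (subst HasC (≡.sym (state-abᵢa i)) at-c) v′)
containsC⇒hasC _ (x ∷ v , u , v′ , cu@(suc _ , _ , refl) , refl) =
  subst HasC (≡.sym (run-containsC (start x) (v , u , v′ , cu , refl))) at-c₊

replicate-swap : ∀ n (x : Letter) ys → replicate n x ++ x ∷ ys ≡ x ∷ replicate n x ++ ys
replicate-swap zero    x ys = refl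
replicate-swap (suc n) x ys = ≡.cong (x ∷_) (replicate-swap n x ys)

replicate-snoc : ∀ n (x : Letter) → replicate n x ++ x ∷ [] ≡ replicate (suc n) x
replicate-snoc n x = ≡.trans (replicate-swap n x []) (≡.cong (x ∷_) (++-identityʳ _))

b*a⁺b⁺a-containsC : ∀ k m l →
  ContainsL ((replicate k b ++ replicate (suc m) a ++ replicate (suc l) b) ++ a ∷ [])
b*a⁺b⁺a-containsC k m l = Bs ++ As , abᵢa (suc l) , [] , (suc l , s≤s z≤n , refl) , split
  where
  Bs = replicate k b
  As = replicate m a
  Ls = replicate (suc l) b
  split : (Bs ++ (a ∷ As) ++ Ls) ++ a ∷ [] ≡ (Bs ++ As) ++ (a ∷ Ls ++ a ∷ []) ++ []
  split = begin
    (Bs ++ (a ∷ As) ++ Ls) ++ a ∷ []     ≡⟨ ++-assoc Bs _ _ ⟩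
    Bs ++ ((a ∷ As) ++ Ls) ++ a ∷ []     ≡⟨ ≡.cong (Bs ++_) (++-assoc (a ∷ As) Ls _) ⟩
    Bs ++ a ∷ As ++ Ls ++ a ∷ []         ≡⟨ ≡.cong (Bs ++_) (replicate-swap m a _) ⟨
    Bs ++ As ++ a ∷ Ls ++ a ∷ []         ≡⟨ ++-assoc Bs As _ ⟨
    (Bs ++ As) ++ a ∷ Ls ++ a ∷ []       ≡⟨ ≡.cong ((Bs ++ As) ++_) (++-identityʳ _) ⟨
    (Bs ++ As) ++ (a ∷ Ls ++ a ∷ []) ++ [] ∎

spells-step : ∀ st x {w} → Spells st w → Spells (step st x) (w ++ x ∷ [])
spells-step (b⁺ k)               a refl = refl
spells-step (b⁺ k)               b refl = ≡.cong (b ∷_) (replicate-snoc k b)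
spells-step (b*a⁺ k m)           a refl =
  ≡.trans (++-assoc (replicate k b) _ _) (≡.cong (replicate k b ++_) (replicate-snoc (suc m) a))
spells-step (b*a⁺ k m)           b refl = ++-assoc (replicate k b) _ _
spells-step (b*a⁺b⁺ zero zero l) a refl = refl
spells-step (b*a⁺b⁺ k (suc m) l) a refl = b*a⁺b⁺a-containsC k (suc m) l
spells-step (b*a⁺b⁺ (suc k) zero l) a refl = b*a⁺b⁺a-containsC (suc k) zero l
spells-step (b*a⁺b⁺ k m l)       b refl = begin
  (Bs ++ As ++ Ls) ++ b ∷ []    ≡⟨ ++-assoc Bs _ _ ⟩
  Bs ++ (As ++ Ls) ++ b ∷ []    ≡⟨ ≡.cong (Bs ++_) (++-assoc As Ls _) ⟩
  Bs ++ As ++ Ls ++ b ∷ []      ≡⟨ ≡.cong (λ ys → Bs ++ As ++ ys) (replicate-snoc (suc l) b) ⟩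
  Bs ++ As ++ b ∷ Ls            ∎
  where
  Bs = replicate k b
  As = replicate (suc m) a
  Ls = replicate (suc l) b
spells-step (c l)                x refl = [] , abᵢa (suc l) , x ∷ [] , (suc l , s≤s z≤n , refl) , refl
spells-step c₊                   x (v , u , v′ , cu , refl) =
  v , u , v′ ++ x ∷ [] , cu , ≡.trans (++-assoc v _ _) (≡.cong (v ++_) (++-assoc (toList u) v′ _))

spells-run : ∀ st xs {w} → Spells st w → Spells (run st xs) (w ++ xs)
spells-run st []       {w} s = subst (Spells st) (≡.sym (++-identityʳ w)) s
spells-run st (x ∷ xs) {w} s = subst (Spells (run (step st x) xs)) (++-assoc w _ xs)
  (spells-run (step st x) xs (spells-step st x s))

spells-state : ∀ w → Spells (state w) (toList w)
spells-state (a ∷ xs) = spells-run (start a) xs refl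
spells-state (b ∷ xs) = spells-run (start b) xs refl

spells-≡ : ∀ st {u u′} → Spells st u → Spells st u′ → st ≡ c₊ ⊎ u ≡ u′
spells-≡ (b⁺ _)         e e′ = inj₂ (≡.trans e (≡.sym e′))
spells-≡ (b*a⁺ _ _)     e e′ = inj₂ (≡.trans e (≡.sym e′))
spells-≡ (b*a⁺b⁺ _ _ _) e e′ = inj₂ (≡.trans e (≡.sym e′))
spells-≡ (c _)          e e′ = inj₂ (≡.trans e (≡.sym e′))
spells-≡ c₊             _ _  = inj₁ refl

toList-injective : ∀ {v w : Word} → toList v ≡ toList w → v ≡ w
toList-injective {_ ∷ _} {_ ∷ _} refl = refl

state≡c⇒abᵢa : ∀ {w l} → state w ≡ c l → w ≡ abᵢa (suc l)
state≡c⇒abᵢa {w} e = toList-injective (subst (λ s → Spells s (toList w)) e (spells-state w))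

state≡c₊⇒InC₊ : ∀ {w} → state w ≡ c₊ → InC₊ w
state≡c₊⇒InC₊ {w} e = subst (λ s → Spells s (toList w)) e (spells-state w) , ¬inC
  where
  ¬inC : InC w → ⊥
  ¬inC (zero  , ()  , _)
  ¬inC (suc i , _   , refl) with ≡.trans (≡.sym e) (state-abᵢa i)
  ... | ()

InC₊⇒state≡c₊ : ∀ {w} → InC₊ w → state w ≡ c₊
InC₊⇒state≡c₊ {w} (cw , ¬inC) =
  hasC⇒≡c₊ (containsC⇒hasC w cw) (λ l e → ¬inC (suc l , s≤s z≤n , state≡c⇒abᵢa e))

state-≡ : ∀ {v w} → state v ≡ state w → (InC₊ v × InC₊ w) ⊎ v ≡ w
state-≡ {v} {w} e with spells-≡ (state v) (spells-state v)
                         (subst (λ s → Spells s (toList w)) (≡.sym e) (spells-state w))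
... | inj₁ v↦c₊ = inj₁ (state≡c₊⇒InC₊ v↦c₊ , state≡c₊⇒InC₊ (≡.trans (≡.sym e) v↦c₊))
... | inj₂ v≡w  = inj₂ (toList-injective v≡w)

state-++-containsC₁ : ∀ v w → ContainsC v → state (v ⁺++⁺ w) ≡ c₊
state-++-containsC₁ v (y ∷ ys) cv = ≡.trans (state-++ v (y ∷ ys)) (hasC-run⁺ (containsC⇒hasC v cv) y ys)

state-++-containsC₂ : ∀ v w → ContainsC w → state (v ⁺++⁺ w) ≡ c₊
state-++-containsC₂ v w cw = ≡.trans (state-++ v w) (run-containsC (state v) cw)

b^_a∷_ : ℕ → List Letter → Word
b^ zero  a∷ ys = a ∷ ys
b^ suc k a∷ ys = b ∷ (replicate k b ++ a ∷ ys)

state-b^a∷ : ∀ k ys → state (b^ k a∷ ys) ≡ run (b*a⁺ k 0) ys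
state-b^a∷ zero    ys = refl
state-b^a∷ (suc k) ys = ≡.trans (run-replicate b⁺ b (λ _ → refl) k 0 (a ∷ ys))
  (≡.cong (λ j → run (b*a⁺ (suc j) 0) ys) (+-identityʳ k))

state-surjective : StrictlySurjective _≡_ state
state-surjective (b⁺ k) = b ∷ (replicate k b ++ []) ,
  ≡.trans (run-replicate b⁺ b (λ _ → refl) k 0 []) (≡.cong b⁺ (+-identityʳ k))
state-surjective (b*a⁺ k m) = b^ k a∷ (replicate m a ++ []) , (begin
  state (b^ k a∷ (replicate m a ++ []))  ≡⟨ state-b^a∷ k _ ⟩
  run (b*a⁺ k 0) (replicate m a ++ []) ≡⟨ run-replicate (b*a⁺ k) a (λ _ → refl) m 0 [] ⟩
  b*a⁺ k (m + 0)                       ≡⟨ ≡.cong (b*a⁺ k) (+-identityʳ m) ⟩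
  b*a⁺ k m                             ∎)
state-surjective (b*a⁺b⁺ k m l) = b^ k a∷ (replicate m a ++ b ∷ (replicate l b ++ [])) , (begin
  state (b^ k a∷ (replicate m a ++ b ∷ (replicate l b ++ [])))
    ≡⟨ state-b^a∷ k _ ⟩
  run (b*a⁺ k 0) (replicate m a ++ b ∷ (replicate l b ++ []))
    ≡⟨ run-replicate (b*a⁺ k) a (λ _ → refl) m 0 _ ⟩
  run (b*a⁺b⁺ k (m + 0) 0) (replicate l b ++ [])
    ≡⟨ run-replicate (b*a⁺b⁺ k (m + 0)) b (λ _ → refl) l 0 [] ⟩
  b*a⁺b⁺ k (m + 0) (l + 0)
    ≡⟨ ≡.cong₂ (b*a⁺b⁺ k) (+-identityʳ m) (+-identityʳ l) ⟩
  b*a⁺b⁺ k m l ∎)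
state-surjective (c l) = abᵢa (suc l) , state-abᵢa l
state-surjective c₊    = a ∷ b ∷ a ∷ a ∷ [] , refl

-- A state off C is indexed by the shape b^k a^m b^l of its words as pair (k , j),
-- where j = 0 if m = 0 and j = suc (pair (m - 1 , l)) otherwise; the index of the
-- empty shape is reused for c₊.
index : State → ℕ ⊎ ℕ
index (c l)          = inj₁ l
index c₊             = inj₂ (pair (0 , 0))
index (b⁺ k)         = inj₂ (pair (suc k , 0))
index (b*a⁺ k m)     = inj₂ (pair (k , suc (pair (m , 0))))
index (b*a⁺b⁺ k m l) = inj₂ (pair (k , suc (pair (m , suc l))))

fromA⁺ : ℕ → ℕ × ℕ → State
fromA⁺ k (m , zero)  = b*a⁺ k m
fromA⁺ k (m , suc l) = b*a⁺b⁺ k m l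

fromShape : ℕ × ℕ → State
fromShape (k     , suc j) = fromA⁺ k (unpair j)
fromShape (zero  , zero)  = c₊
fromShape (suc k , zero)  = b⁺ k

unindex : ℕ ⊎ ℕ → State
unindex (inj₁ l) = c l
unindex (inj₂ n) = fromShape (unpair n)

unindex-index : ∀ st → unindex (index st) ≡ st
unindex-index (c l)          = refl
unindex-index c₊             = refl
unindex-index (b⁺ k)         = ≡.cong fromShape (unpair-pair (suc k , 0))
unindex-index (b*a⁺ k m)     =
  ≡.trans (≡.cong fromShape (unpair-pair _)) (≡.cong (fromA⁺ k) (unpair-pair (m , 0)))
unindex-index (b*a⁺b⁺ k m l) =
  ≡.trans (≡.cong fromShape (unpair-pair _)) (≡.cong (fromA⁺ k) (unpair-pair (m , suc l)))

index-fromA⁺ : ∀ k s → index (fromA⁺ k s) ≡ inj₂ (pair (k , suc (pair s)))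
index-fromA⁺ k (m , zero)  = refl
index-fromA⁺ k (m , suc l) = refl

index-fromShape : ∀ s → index (fromShape s) ≡ inj₂ (pair s)
index-fromShape (k     , suc j) =
  ≡.trans (index-fromA⁺ k (unpair j)) (≡.cong (λ i → inj₂ (pair (k , suc i))) (pair-unpair j))
index-fromShape (zero  , zero)  = refl
index-fromShape (suc k , zero)  = refl

index-unindex : ∀ p → index (unindex p) ≡ p
index-unindex (inj₁ l) = refl
index-unindex (inj₂ n) = ≡.trans (index-fromShape (unpair n)) (≡.cong inj₂ (pair-unpair n))

index-injective : ∀ {st st′} → index st ≡ index st′ → st ≡ st′
index-injective {st} {st′} e = begin
  st                  ≡⟨ unindex-index st ⟨
  unindex (index st)  ≡⟨ ≡.cong unindex e ⟩
  unindex (index st′) ≡⟨ unindex-index st′ ⟩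
  st′                 ∎

classify : Word → ℕ ⊎ ℕ
classify = index ∘ state

classify-surjective : StrictlySurjective _≡_ classify
classify-surjective = strictlySurjective-∘ {g = index} state-surjective (λ p → unindex p , index-unindex p)

classify-≡ : ∀ {v w} → classify v ≡ classify w → (InC₊ v × InC₊ w) ⊎ v ≡ w
classify-≡ = state-≡ ∘ index-injective

classify≡inj₁⇒abᵢa : ∀ {w l} → classify w ≡ inj₁ l → w ≡ abᵢa (suc l)
classify≡inj₁⇒abᵢa = state≡c⇒abᵢa ∘ index-injective

module _ {R : ℕ → ℕ → Set} (isEquivalence-R : IsEquivalence R) where

  open IsEquivalence (⊎-isEquivalence isEquivalence-R (≡.isEquivalence {A = ℕ}))
    using () renaming (refl to ≈-refl; sym to ≈-sym; trans to ≈-trans)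

  _≈_ : Word → Word → Set
  v ≈ w = Pointwise R _≡_ (classify v) (classify w)

  both-c₊ : ∀ v w → state v ≡ c₊ → state w ≡ c₊ → v ≈ w
  both-c₊ _ _ v↦c₊ w↦c₊ = subst₂ (Pointwise R _≡_)
    (≡.sym (≡.cong index v↦c₊)) (≡.sym (≡.cong index w↦c₊)) (inj₂ refl)

  InC⇒ContainsC : ∀ {w} → InC w → ContainsC w
  InC⇒ContainsC {w} inC = [] , w , [] , inC , ≡.sym (++-identityʳ (toList w))

  ≈-cases : ∀ {v w} → v ≈ w → (ContainsC v × ContainsC w) ⊎ v ≡ w
  ≈-cases {v} {w} = go refl refl
    where
    go : ∀ {p q} → classify v ≡ p → classify w ≡ q → Pointwise R _≡_ p q →
      (ContainsC v × ContainsC w) ⊎ v ≡ w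
    go {inj₁ l} {inj₁ l′} ev ew (inj₁ _) =
      inj₁ ( InC⇒ContainsC (suc l  , s≤s z≤n , classify≡inj₁⇒abᵢa ev)
           , InC⇒ContainsC (suc l′ , s≤s z≤n , classify≡inj₁⇒abᵢa ew))
    go ev ew (inj₂ refl) = map₁ (λ (pv , pw) → proj₁ pv , proj₁ pw) (classify-≡ (≡.trans ev (≡.sym ew)))

  ≈-cong : ∀ {v w v′ w′} → v ≈ w → v′ ≈ w′ → (v ⁺++⁺ v′) ≈ (w ⁺++⁺ w′)
  ≈-cong {v} {w} {v′} {w′} v≈w v′≈w′ with ≈-cases v≈w
  ... | inj₁ (cv , cw) = both-c₊ (v ⁺++⁺ v′) (w ⁺++⁺ w′) (state-++-containsC₁ v v′ cv) (state-++-containsC₁ w w′ cw)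
  ... | inj₂ refl with ≈-cases v′≈w′
  ...   | inj₁ (cv′ , cw′) = both-c₊ (v ⁺++⁺ v′) (v ⁺++⁺ w′) (state-++-containsC₂ v v′ cv′) (state-++-containsC₂ v w′ cw′)
  ...   | inj₂ refl = ≈-refl

  SR⇒≈ : ∀ {v w} → SR R v w → v ≈ w
  SR⇒≈ (gen {i} {j} r) = subst₂ (Pointwise R _≡_)
    (≡.sym (≡.cong index (state-abᵢa i))) (≡.sym (≡.cong index (state-abᵢa j))) (inj₁ r)
  SR⇒≈ (plus {v} {w} pv pw) = both-c₊ v w (InC₊⇒state≡c₊ pv) (InC₊⇒state≡c₊ pw)
  SR⇒≈ refl           = ≈-refl
  SR⇒≈ (sym s)        = ≈-sym (SR⇒≈ s)
  SR⇒≈ (trans s s′)   = ≈-trans (SR⇒≈ s) (SR⇒≈ s′)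
  SR⇒≈ (cong {v} {w} {v′} {w′} s s′) = ≈-cong {v} {w} {v′} {w′} (SR⇒≈ s) (SR⇒≈ s′)

  ≈⇒SR : ∀ {v w} → v ≈ w → SR R v w
  ≈⇒SR {v} {w} = go refl refl
    where
    go : ∀ {p q} → classify v ≡ p → classify w ≡ q → Pointwise R _≡_ p q → SR R v w
    go ev ew (inj₁ r) = subst₂ (SR R)
      (≡.sym (classify≡inj₁⇒abᵢa ev)) (≡.sym (classify≡inj₁⇒abᵢa ew)) (gen r)
    go ev ew (inj₂ refl) with classify-≡ (≡.trans ev (≡.sym ew))
    ... | inj₁ (pv , pw) = plus pv pw
    ... | inj₂ refl      = refl

  classify-reduction : SR R ≤c Pointwise R _≡_ via classify
  classify-reduction _ _ = SR⇒≈ , ≈⇒SR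

lemma3p2 : (R : ℕ → ℕ → Set) → IsCeer R →
    Isomorphic (SR R) (R ⊕ Idω) × (SR R ≡c (R ⊕ Idω))
lemma3p2 R (isEquivalence-R , _) =
  surjective-reduction⇒isomorphic {V = R ⊕ Idω} refl reduction surjective ,
  surjective-reduction⇒≡c reduction surjective
  where
  reduction : SR R ≤c (R ⊕ Idω) via (encode ∘ classify)
  reduction = ≤c-∘ {W = R ⊕ Idω} {g = encode} (classify-reduction isEquivalence-R) encode-reduction

  surjective : StrictlySurjective _≡_ (encode ∘ classify)
  surjective = strictlySurjective-∘ classify-surjective encode-surjective
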